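{- Let $n\geq 3$ be an integer. Then $$t(n,3,5)\leq 2n-2.$$
   Context: All graphs are finite, undirected and simple. Let $G$ be a nontrivial connected graph of order $n$ (i.e. with $n$ vertices). An edge-coloring of $G$ is any assignment of colors to the edges (adjacent edges may receive the same color). A tree $T$ that is a subgraph of $G$ is a rainbow tree if no two edges of $T$ have the same color. For $S\subseteq V(G)$ with $|S|\geq 2$, a rainbow $S$-tree is a rainbow tree $T$ in $G$ with $S\subseteq V(T)$. For an integer $k$ with $2\leq k\leq n$, an edge-coloring of $G$ is a $k$-rainbow coloring if for every $k$-subset $S$ of $V(G)$ there exists a rainbow $S$-tree. The $k$-rainbow index $rx_k(G)$ is the minimum number of colors needed in a $k$-rainbow coloring of $G$. For integers $2\leq k\leq n$ and $\ell\geq 2$, $t(n,k,\ell)$ denotes the minimum size (number of edges) of a connected graph $G$ of order $n$ with $rx_k(G)\leq \ell$ (when such a graph exists). -}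

module Defs where

open import Data.Nat using (ℕ; _≤_)
open import Data.Fin using (Fin; _<?_)
open import Data.Fin.Subset using (Subset; _∈_; _⊆_; ∣_∣; Nonempty)
open import Data.Fin.Subset.Properties using (_∈?_)
open import Data.List using (List; _∷_; []; _++_; length; filter; allFin; cartesianProduct)
open import Data.List.Relation.Unary.Linked using (Linked)
open import Data.List.Relation.Unary.Unique.Propositional using (Unique)
open import Data.Product using (∃-syntax; _×_; _,_)
open import Data.Sum using (_⊎_)
open import Data.Vec using (Vec; lookup)
open import Relation.Binary.Construct.Closure.ReflexiveTransitive using (Star)
open import Relation.Binary.PropositionalEquality using (_≡_)
open import Relation.Nullary using (¬_)
open import Relation.Nullary.Decidable using (_×-dec_)

-- An adjacency matrix, stored as the vector of neighbourhoods.
Adjacency : ℕ → Set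
Adjacency n = Vec (Subset n) n

Joins : ∀ {n} → Adjacency n → Fin n → Fin n → Set
Joins A u v = v ∈ lookup A u

record Graph (n : ℕ) : Set where
  field
    adjacency : Adjacency n

  Adj : Fin n → Fin n → Set
  Adj = Joins adjacency

  field
    symmetric   : ∀ u v → Adj u v → Adj v u
    irreflexive : ∀ u → ¬ Adj u u

open Graph public using (Adj)

-- Each undirected edge is counted once, through its orientation u < v.
size : ∀ {n} → Graph n → ℕ
size {n} G =
  length (filter (λ (u , v) → (u <? v) ×-dec (v ∈? lookup (Graph.adjacency G) u))
                 (cartesianProduct (allFin n) (allFin n)))

Connected : ∀ {n} → Graph n → Set
Connected G = ∀ u v → Star (Adj G) u v

record Subgraph {n : ℕ} (G : Graph n) : Set where
  field
    vertices  : Subset n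
    adjacency : Adjacency n

  Edge : Fin n → Fin n → Set
  Edge = Joins adjacency

  field
    symmetric : ∀ u v → Edge u v → Edge v u
    edges⊆    : ∀ u v → Edge u v → Adj G u v
    -- By symmetry the other endpoint is a vertex as well.
    endpoint  : ∀ u v → Edge u v → u ∈ vertices

open Subgraph public using (vertices; Edge)

-- A cycle u, v₁, …, vₘ, u with m ≥ 2 and u, v₁, …, vₘ pairwise distinct.
IsCycle : ∀ {n} → (Fin n → Fin n → Set) → Fin n → List (Fin n) → Set
IsCycle E u vs = 2 ≤ length vs × Unique (u ∷ vs) × Linked E (u ∷ vs ++ u ∷ [])

record IsTree {n : ℕ} {G : Graph n} (T : Subgraph G) : Set where
  field
    nonempty  : Nonempty (vertices T)
    connected : ∀ u v → u ∈ vertices T → v ∈ vertices T → Star (Edge T) u v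
    acyclic   : ∀ u vs → ¬ IsCycle (Edge T) u vs

-- The colour of the edge uv is `colour u v`; values at non-adjacent pairs are
-- irrelevant, as only colours of edges are ever inspected.
record Colouring (n c : ℕ) : Set where
  field
    colour    : Fin n → Fin n → Fin c
    symmetric : ∀ u v → colour u v ≡ colour v u

open Colouring public using (colour)

IsRainbow : ∀ {n c} {G : Graph n} → Colouring n c → Subgraph G → Set
IsRainbow χ T = ∀ u v x y → Edge T u v → Edge T x y → colour χ u v ≡ colour χ x y →
  (u ≡ x × v ≡ y) ⊎ (u ≡ y × v ≡ x)

IsRainbowSTree : ∀ {n c} {G : Graph n} → Colouring n c → Subset n → Subgraph G → Set
IsRainbowSTree χ S T = IsTree T × IsRainbow χ T × S ⊆ vertices T

IsRainbowColouring : ∀ {n c} → ℕ → Graph n → Colouring n c → Set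
IsRainbowColouring {n} k G χ =
  ∀ (S : Subset n) → ∣ S ∣ ≡ k → ∃[ T ] IsRainbowSTree {G = G} χ S T

IsMinimum : (ℕ → Set) → ℕ → Set
IsMinimum P m = P m × (∀ j → P j → m ≤ j)

-- `RainbowIndex k G r` says that rx_k(G) = r.
RainbowIndex : ∀ {n} → ℕ → Graph n → ℕ → Set
RainbowIndex {n} k G = IsMinimum λ c → ∃[ χ ] IsRainbowColouring {n} {c} k G χ

-- rx_k(G) is defined and at most ℓ.
RainbowIndex≤ : ∀ {n} → ℕ → Graph n → ℕ → Set
RainbowIndex≤ k G ℓ = ∃[ r ] RainbowIndex k G r × r ≤ ℓ

-- `MinSize n k ℓ m` says that t(n,k,ℓ) exists and equals m.
MinSize : ℕ → ℕ → ℕ → ℕ → Set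
MinSize n k ℓ = IsMinimum λ m →
  ∃[ G ] Connected {n} G × RainbowIndex≤ k G ℓ × size G ≡ m

{-# OPTIONS --safe #-}

-- All notions involved are decidable on finite graphs, so a least size exists as soon as one
-- suitable graph is known, and it remains to find one with at most 2(n − 1) edges.
--
-- Join a hub to every other vertex v and add at most one edge from v to a vertex next v. The
-- n − 1 = 6q + r other vertices form q hexagons and r ≤ 5 extra vertices, each tied to the first
-- extra one. On a hexagon the spokes are coloured 0 1 2 0 1 2 and the edges alternately 3 and 4,
-- so each of its vertices reaches the hub by its own spoke or through either neighbour, with
-- colours {i}, {3,j}, {4,k} or {i}, {4,j}, {3,k} where {i,j,k} = {0,1,2}. With the right colours
-- at the extra vertices, any three vertices have routes to the hub with pairwise disjoint colour
-- sets; this depends only on the kinds of the three vertices, and is a finite check. The union of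
-- three such routes contains a rainbow tree.

module Submission where

open import Data.Bool using (if_then_else_)
open import Data.Empty using (⊥)
open import Data.Fin using (Fin; zero; suc; _≟_; _<?_; inject≤)
import Data.Fin as Fin
open import Data.Fin.Patterns using (0F; 1F; 2F; 3F; 4F; 5F)
open import Data.Fin.Properties
  using (any?; all?; injective⇒≤; <-asym; +↔⊎; *↔×; inject≤-injective)
open import Data.Fin.Subset using (Subset; _∈_; _⊃_; _∪_; ⁅_⁆; ∣_∣; inside; outside)
open import Data.Fin.Subset.Induction using (⊃-wellFounded)
open import Data.Fin.Subset.Properties
  using (_∈?_; _⊆?_; nonempty?; anySubset?; x∈⁅x⁆; x∈⁅y⁆⇒x≡y; p⊆p∪q; q⊆p∪q; x∈p∪q⁻)
open import Data.List
  using (List; []; _∷_; [_]; _++_; map; length; allFin; cartesianProduct)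
import Data.List as List
import Data.List.Membership.DecPropositional as DecMembership
open import Data.List.Membership.Propositional using (find) renaming (_∈_ to _∈ₗ_; _∉_ to _∉ₗ_)
open import Data.List.Membership.Propositional.Properties
  using (∈-map⁺; ∈-++⁺ˡ; ∈-++⁺ʳ; ∈-++⁻; ∈-filter⁻; ∈-allFin; ∈-lookup)
open import Data.List.Properties using (length-++; length-map; length-tabulate)
open import Data.List.Relation.Unary.All as All using (All; []; _∷_)
open import Data.List.Relation.Unary.AllPairs using ([]; _∷_)
open import Data.List.Relation.Unary.Any as Any using (Any; here; there; index)
open import Data.List.Relation.Unary.Any.Properties using (lookup-index)
open import Data.List.Relation.Unary.Linked as Linked using (Linked; []; [-]; _∷_; linked?)
open import Data.List.Relation.Unary.Unique.DecPropositional using (unique?)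
open import Data.List.Relation.Unary.Unique.Propositional using (Unique)
open import Data.List.Relation.Unary.Unique.Propositional.Properties
  using (allFin⁺; cartesianProduct⁺; filter⁺)
open import Data.Nat
  using (ℕ; zero; suc; _+_; _*_; _∸_; _/_; _%_; _≤_; _<_; _≤?_; s≤s; s≤s⁻¹)
import Data.Nat as ℕ
open import Data.Nat.DivMod using (m≡m%n+[m/n]*n; m%n<n)
open import Data.Nat.Induction using (<-wellFounded)
open import Data.Nat.Properties
  using (≤-refl; ≤-trans; ≤-reflexive; <⇒≤; ≮⇒≥; anyUpTo?; +-suc; +-identityʳ)
open import Data.Product using (∃; ∃-syntax; _×_; _,_; proj₁; proj₂)
open import Data.Product.Properties using (≡-dec; ,-injectiveʳ)
open import Data.Sum as Sum using (_⊎_; inj₁; inj₂; swap; [_,_]′)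
open import Data.Sum.Function.Propositional using (_⊎-↔_)
open import Data.Sum.Properties using (inj₂-injective)
open import Data.Unit using (⊤; tt)
open import Data.Vec using (Vec; []; _∷_; here; there; lookup; tabulate; toList; fromList)
open import Data.Vec.Properties
  using (lookup∘tabulate; tabulate∘lookup; tabulate-cong; toList∘fromList; []=⇒lookup; lookup⇒[]=)
open import Function using (_∘_; id)
open import Function.Bundles using (_↔_; Inverse)
open import Function.Properties.Inverse using (↔-refl; ↔-trans)
open import Induction.WellFounded using (Acc; acc)
open import Relation.Binary.Construct.Closure.ReflexiveTransitive as Star
  using (Star; ε; _◅_; _◅◅_; reverse)
open import Relation.Binary.PropositionalEquality
  using (_≡_; _≢_; refl; sym; trans; cong; cong₂; subst)
open import Relation.Nullary using (¬_; Dec; yes; no; does; contradiction)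
open import Relation.Nullary.Decidable
  using (_×-dec_; _⊎-dec_; _→-dec_; ¬?; map′; decidable-stable; dec-true; toWitness)
open import Defs

-- Decidability

-- Finiteness in the form that gets used: existence is decided for every decidable predicate. `any?`
-- and `anySubset?` are the base cases.
Searchable : Set → Set₁
Searchable A = {P : A → Set} → (∀ a → Dec (P a)) → Dec (∃ P)

search-Vec : ∀ {A} → Searchable A → ∀ n → Searchable (Vec A n)
search-Vec search zero    P? = map′ ([] ,_) (λ { ([] , p) → p }) (P? [])
search-Vec search (suc n) P? =
  map′ (λ (x , xs , p) → x ∷ xs , p) (λ { (x ∷ xs , p) → x , xs , p })
       (search λ x → search-Vec search n λ xs → P? (x ∷ xs))

search-× : ∀ {A B} → Searchable A → Searchable B → Searchable (A × B)
search-× searchA searchB P? =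
  map′ (λ (a , b , p) → (a , b) , p) (λ ((a , b) , p) → a , b , p)
       (searchA λ a → searchB λ b → P? (a , b))

search-Adjacency : ∀ n → Searchable (Adjacency n)
search-Adjacency n = search-Vec anySubset? n

universal? : ∀ {A} → Searchable A → {P : A → Set} → (∀ a → Dec (P a)) → Dec (∀ a → P a)
universal? search P? with search (λ a → ¬? (P? a))
... | yes (a , ¬p) = no λ p → ¬p (p a)
... | no ¬∃¬p      = yes λ a → decidable-stable (P? a) λ ¬p → ¬∃¬p (a , ¬p)

-- Records with proof or function fields cannot be enumerated up to _≡_, so they are
-- searched through codes, for predicates that only depend on the code.
search-via : ∀ {A B : Set} {Valid : B → Set} → Searchable B → (∀ b → Dec (Valid b)) →
  (decode : ∀ b → Valid b → A) (encode : A → B) →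
  (∀ a → Valid (encode a)) → (∀ b v → encode (decode b v) ≡ b) →
  {P : A → Set} → (∀ a → Dec (P a)) → (∀ a a′ → encode a ≡ encode a′ → P a → P a′) →
  Dec (∃ P)
search-via {A} search valid? decode encode valid decoded {P} P? resp =
  map′ (λ (_ , a , _ , p) → a , p) (λ (a , p) → encode a , a , refl , p) (search coded?)
  where
  coded? : ∀ b → Dec (∃[ a ] encode a ≡ b × P a)
  coded? b with valid? b
  ... | no ¬v = no λ { (a , refl , p) → ¬v (valid a) }
  ... | yes v with P? (decode b v)
  ...   | yes p = yes (decode b v , decoded b v , p)
  ...   | no ¬p = no λ { (a , eq , p) → ¬p (resp a (decode b v) (trans eq (sym (decoded b v))) p) }

-- Restart from a smaller witness until there is none. This yields the exact rainbow index from one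
-- colouring and the exact minimum size from one graph.
least : ∀ {P : ℕ → Set} → (∀ m → Dec (P m)) → ∀ m → P m → ∃[ k ] IsMinimum P k × k ≤ m
least {P} P? m = descend (<-wellFounded m)
  where
  descend : ∀ {m} → Acc _<_ m → P m → ∃[ k ] IsMinimum P k × k ≤ m
  descend {m} (acc rs) pm with anyUpTo? P? m
  ... | no none = m , (pm , λ j pj → ≮⇒≥ λ j<m → none (j , j<m , pj)) , ≤-refl
  ... | yes (j , j<m , pj) =
    let (k , min , k≤j) = descend (rs j<m) pj in k , min , ≤-trans k≤j (<⇒≤ j<m)

module _ {n : ℕ} {E : Fin n → Fin n → Set} (E? : ∀ u v → Dec (E u v)) where

  -- Enlarge a set of reached vertices along edges that leave it; strict growth is well-founded.
  -- Once no edge leaves the set, a walk from `u` cannot escape it.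
  reachable? : ∀ u v → Dec (Star E u v)
  reachable? u v = saturate ⁅ u ⁆ (⊃-wellFounded ⁅ u ⁆) (x∈⁅x⁆ u)
                     λ x x∈ → subst (Star E u) (sym (x∈⁅y⁆⇒x≡y u x∈)) ε
    where
    saturate : (X : Subset n) → Acc _⊃_ X → u ∈ X → (∀ x → x ∈ X → Star E u x) → Dec (Star E u v)
    saturate X (acc rs) u∈X reached
      with any? (λ x → any? (λ y → (x ∈? X) ×-dec E? x y ×-dec ¬? (y ∈? X)))
    ... | yes (x , y , x∈X , e , y∉X) =
      saturate (X ∪ ⁅ y ⁆)
        (rs (p⊆p∪q ⁅ y ⁆ , y , q⊆p∪q X ⁅ y ⁆ (x∈⁅x⁆ y) , y∉X))
        (p⊆p∪q ⁅ y ⁆ u∈X) reached′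
      where
      reached′ : ∀ z → z ∈ X ∪ ⁅ y ⁆ → Star E u z
      reached′ z z∈ with x∈p∪q⁻ X ⁅ y ⁆ z∈
      ... | inj₁ z∈X = reached z z∈X
      ... | inj₂ z∈y rewrite x∈⁅y⁆⇒x≡y y z∈y = reached x x∈X ◅◅ (e ◅ ε)
    ... | no closed with v ∈? X
    ...   | yes v∈X = yes (reached v v∈X)
    ...   | no v∉X = no λ walk → v∉X (follow u∈X walk)
      where
      follow : ∀ {x} → x ∈ X → Star E x v → v ∈ X
      follow x∈X ε = x∈X
      follow x∈X (_◅_ {j = y} e walk) =
        follow (decidable-stable (y ∈? X) λ y∉X → closed (_ , y , x∈X , e , y∉X)) walk

  isCycle? : ∀ u vs → Dec (IsCycle E u vs)
  isCycle? u vs =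
    (2 ≤? length vs) ×-dec unique? _≟_ (u ∷ vs) ×-dec linked? E? (u ∷ vs ++ u ∷ [])

Unique-lookup-injective : ∀ {A : Set} {xs : List A} → Unique xs → ∀ {i j} →
  List.lookup xs i ≡ List.lookup xs j → i ≡ j
Unique-lookup-injective (_ ∷ _) {zero} {zero} _ = refl
Unique-lookup-injective (x∉ ∷ _) {zero} {suc j} eq = contradiction eq (All.lookup x∉ (∈-lookup j))
Unique-lookup-injective (x∉ ∷ _) {suc i} {zero} eq = contradiction (sym eq) (All.lookup x∉ (∈-lookup i))
Unique-lookup-injective (_ ∷ u) {suc i} {suc j} eq = cong suc (Unique-lookup-injective u eq)

Unique⇒length≤ : ∀ {n} {xs : List (Fin n)} → Unique xs → length xs ≤ n
Unique⇒length≤ uniq = injective⇒≤ (Unique-lookup-injective uniq)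

search-short-lists : ∀ {n} {P : List (Fin n) → Set} → (∀ xs → Dec (P xs)) →
  ∀ b → (∀ xs → P xs → length xs < b) → Dec (∃ P)
search-short-lists {n} {P} P? b short =
  map′ (λ (_ , _ , xs , p) → toList xs , p)
       (λ (xs , p) → length xs , short xs p , fromList xs , subst P (sym (toList∘fromList xs)) p)
       (anyUpTo? (λ l → search-Vec any? l (P? ∘ toList)) b)

acyclic? : ∀ {n} {E : Fin n → Fin n → Set} → (∀ u v → Dec (E u v)) →
  Dec (∀ u vs → ¬ IsCycle E u vs)
acyclic? {n} E? =
  map′ (λ none u vs cyc → none (u , vs , cyc)) (λ none (u , vs , cyc) → none u vs cyc)
    (¬? (any? λ u → search-short-lists (isCycle? E? u) n
                      -- `uniq` is about `u ∷ vs`, so its bound by `n` reads `length vs < n`, and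
                      -- only finitely many lists remain.
                      λ vs (_ , uniq , _) → Unique⇒length≤ uniq))

-- Search over subgraphs, colourings and graphs

joins? : ∀ {n} (A : Adjacency n) u v → Dec (Joins A u v)
joins? A u v = v ∈? lookup A u

Symmetric Irreflexive : ∀ {n} → Adjacency n → Set
Symmetric A = ∀ u v → Joins A u v → Joins A v u
Irreflexive A = ∀ u → ¬ Joins A u u

symmetric? : ∀ {n} (A : Adjacency n) → Dec (Symmetric A)
symmetric? A = all? λ u → all? λ v → joins? A u v →-dec joins? A v u

irreflexive? : ∀ {n} (A : Adjacency n) → Dec (Irreflexive A)
irreflexive? A = all? λ u → ¬? (joins? A u u)

module _ {n : ℕ} {G : Graph n} where

  IsTree? : (T : Subgraph G) → Dec (IsTree T)
  IsTree? T =
    map′ (λ (ne , co , ac) → record { nonempty = ne ; connected = co ; acyclic = ac })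
         (λ t → IsTree.nonempty t , IsTree.connected t , IsTree.acyclic t)
         (nonempty? (vertices T)
           ×-dec (all? λ u → all? λ v →
                    (u ∈? vertices T) →-dec (v ∈? vertices T) →-dec reachable? edge? u v)
           ×-dec acyclic? edge?)
    where
    edge? : ∀ u v → Dec (Edge T u v)
    edge? = joins? (Subgraph.adjacency T)

  IsRainbow? : ∀ {c} (χ : Colouring n c) (T : Subgraph G) → Dec (IsRainbow χ T)
  IsRainbow? χ T = all? λ u → all? λ v → all? λ x → all? λ y →
    edge? u v →-dec edge? x y →-dec (colour χ u v ≟ colour χ x y) →-dec
      ((u ≟ x) ×-dec (v ≟ y) ⊎-dec (u ≟ y) ×-dec (v ≟ x))
    where
    edge? : ∀ u v → Dec (Edge T u v)
    edge? = joins? (Subgraph.adjacency T)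

  IsRainbowSTree? : ∀ {c} (χ : Colouring n c) S (T : Subgraph G) → Dec (IsRainbowSTree χ S T)
  IsRainbowSTree? χ S T = IsTree? T ×-dec IsRainbow? χ T ×-dec (S ⊆? vertices T)

-- The property reads only `vertices` and `adjacency` of the subgraph, never the ambient graph, so
-- `G` and `G′` may differ.
IsRainbowSTree-resp : ∀ {n c} {G G′ : Graph n} {χ χ′ : Colouring n c} {S} →
  (∀ u v → colour χ u v ≡ colour χ′ u v) → (T : Subgraph G) (T′ : Subgraph G′) →
  (vertices T , Subgraph.adjacency T) ≡ (vertices T′ , Subgraph.adjacency T′) →
  IsRainbowSTree χ S T → IsRainbowSTree χ′ S T′
-- Opening the records turns their fields into variables, so that the equation of codes can be
-- matched with `refl`.
IsRainbowSTree-resp χ≈χ′ record {} record {} refl (tree , rainbow , S⊆T) =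
  record { IsTree tree } ,
  (λ u v x y e f eq → rainbow u v x y e f (trans (χ≈χ′ u v) (trans eq (sym (χ≈χ′ x y))))) ,
  S⊆T

search-Subgraph : ∀ {n c} {G : Graph n} (χ : Colouring n c) S →
  Dec (∃[ T ] IsRainbowSTree {G = G} χ S T)
search-Subgraph {n} {G = G} χ S =
  search-via (search-× anySubset? (search-Adjacency n))
    (λ (V , A) → symmetric? A
      ×-dec (all? λ u → all? λ v → joins? A u v →-dec joins? (Graph.adjacency G) u v)
      ×-dec (all? λ u → all? λ v → joins? A u v →-dec (u ∈? V)))
    (λ (V , A) (s , e , p) → record
      { vertices = V ; adjacency = A ; symmetric = s ; edges⊆ = e ; endpoint = p })
    (λ T → vertices T , Subgraph.adjacency T)
    (λ T → Subgraph.symmetric T , Subgraph.edges⊆ T , Subgraph.endpoint T)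
    (λ _ _ → refl)
    (IsRainbowSTree? χ S)
    (IsRainbowSTree-resp {χ = χ} {χ} (λ _ _ → refl))

IsRainbowColouring? : ∀ {n c} k (G : Graph n) (χ : Colouring n c) →
  Dec (IsRainbowColouring k G χ)
IsRainbowColouring? k G χ =
  universal? anySubset? λ S → (∣ S ∣ ℕ.≟ k) →-dec search-Subgraph χ S

IsRainbowColouring-resp : ∀ {n c k} {G G′ : Graph n} {χ χ′ : Colouring n c} →
  (∀ u v → colour χ u v ≡ colour χ′ u v) → Graph.adjacency G ≡ Graph.adjacency G′ →
  IsRainbowColouring k G χ → IsRainbowColouring k G′ χ′
IsRainbowColouring-resp {G = record {}} {record {}} {χ} {χ′} χ≈χ′ refl rainbow S ∣S∣≡k =
  let (T , tree) = rainbow S ∣S∣≡k in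
  record { Subgraph T } , IsRainbowSTree-resp {χ = χ} {χ′} χ≈χ′ T _ refl tree

-- Colourings contain functions, and equal tables give only pointwise equal colours; hence the
-- pointwise hypothesis of `IsRainbowColouring-resp`.
table : ∀ {n c} → Colouring n c → Vec (Vec (Fin c) n) n
table χ = tabulate λ u → tabulate (colour χ u)

lookup-table : ∀ {n c} (χ : Colouring n c) u v → lookup (lookup (table χ) u) v ≡ colour χ u v
lookup-table χ u v =
  trans (cong (λ row → lookup row v) (lookup∘tabulate (λ u → tabulate (colour χ u)) u))
        (lookup∘tabulate (colour χ u) v)

search-Colouring : ∀ {n} c k (G : Graph n) →
  Dec (∃[ χ ] IsRainbowColouring {n} {c} k G χ)
search-Colouring {n} c k G =
  search-via (search-Vec (search-Vec any? n) n)
    (λ M → all? λ u → all? λ v → lookup (lookup M u) v ≟ lookup (lookup M v) u)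
    (λ M s → record { colour = λ u v → lookup (lookup M u) v ; symmetric = s })
    table
    (λ χ u v → trans (lookup-table χ u v)
                 (trans (Colouring.symmetric χ u v) (sym (lookup-table χ v u))))
    (λ M _ → trans (tabulate-cong λ u → tabulate∘lookup (lookup M u)) (tabulate∘lookup M))
    (IsRainbowColouring? k G)
    (λ χ χ′ eq → IsRainbowColouring-resp {k = k} {G} {G} {χ} {χ′}
      (λ u v → trans (sym (lookup-table χ u v))
                 (trans (cong (λ M → lookup (lookup M u) v) eq) (lookup-table χ′ u v)))
      refl)

RainbowIndex≤-intro : ∀ {n c} k (G : Graph n) → ∃[ χ ] IsRainbowColouring {n} {c} k G χ →
  ∀ {ℓ} → c ≤ ℓ → RainbowIndex≤ k G ℓ
RainbowIndex≤-intro {c = c} k G colourable c≤ℓ =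
  let (r , index , r≤c) = least (λ r → search-Colouring r k G) c colourable in
  r , index , ≤-trans r≤c c≤ℓ

-- An index of at most `ℓ` amounts to some rainbow colouring with at most `ℓ` colours, and only
-- finitely many colour counts have to be tried.
RainbowIndex≤? : ∀ {n} k (G : Graph n) ℓ → Dec (RainbowIndex≤ k G ℓ)
RainbowIndex≤? k G ℓ =
  map′ (λ (_ , c<1+ℓ , colourable) → RainbowIndex≤-intro k G colourable (s≤s⁻¹ c<1+ℓ))
       (λ (r , (colourable , _) , r≤ℓ) → r , s≤s r≤ℓ , colourable)
       (anyUpTo? (λ c → search-Colouring c k G) (ℕ.suc ℓ))

RainbowIndex≤-resp : ∀ {n k ℓ} {G G′ : Graph n} → Graph.adjacency G ≡ Graph.adjacency G′ →
  RainbowIndex≤ k G ℓ → RainbowIndex≤ k G′ ℓ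
RainbowIndex≤-resp {k = k} {G = G} {G′} eq (r , ((χ , rainbow) , _) , r≤ℓ) =
  RainbowIndex≤-intro k G′
    (χ , IsRainbowColouring-resp {G = G} {G′} {χ} {χ} (λ _ _ → refl) eq rainbow) r≤ℓ

search-Graph : ∀ n k ℓ m →
  Dec (∃[ G ] Connected {n} G × RainbowIndex≤ k G ℓ × size G ≡ m)
search-Graph n k ℓ m =
  search-via (search-Adjacency n) (λ A → symmetric? A ×-dec irreflexive? A)
    (λ A (s , i) → record { adjacency = A ; symmetric = s ; irreflexive = i })
    Graph.adjacency (λ G → Graph.symmetric G , Graph.irreflexive G) (λ _ _ → refl)
    (λ G → (all? λ u → all? λ v → reachable? (joins? (Graph.adjacency G)) u v)
      ×-dec RainbowIndex≤? k G ℓ ×-dec (size G ℕ.≟ m))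
    resp
  where
  resp : ∀ G G′ → Graph.adjacency G ≡ Graph.adjacency G′ →
    Connected G × RainbowIndex≤ k G ℓ × size G ≡ m →
    Connected G′ × RainbowIndex≤ k G′ ℓ × size G′ ≡ m
  resp G@(record {}) G′@(record {}) refl (connected , index , size≡m) =
    connected , RainbowIndex≤-resp {G = G} {G′} refl index , size≡m

-- Reduces the theorem to exhibiting one graph: since suitability at a given size is decidable,
-- `least` descends from `size G` to the minimum.
MinSize-≤ : ∀ {n k ℓ} (G : Graph n) → Connected G → RainbowIndex≤ k G ℓ →
  ∃[ m ] MinSize n k ℓ m × m ≤ size G
MinSize-≤ {n} {k} {ℓ} G connected index =
  least (search-Graph n k ℓ) (size G) (G , connected , index , refl)

-- Rainbow trees grown leaf by leaf

module _ {n : ℕ} {P : Fin n → Set} (P? : ∀ u → Dec (P u)) where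

  subset : Subset n
  subset = tabulate (does ∘ P?)

  ∈subset⁺ : ∀ {u} → P u → u ∈ subset
  ∈subset⁺ {u} p = lookup⇒[]= u subset (trans (lookup∘tabulate (does ∘ P?) u) (dec-true (P? u) p))

  ∈subset⁻ : ∀ {u} → u ∈ subset → P u
  ∈subset⁻ {u} u∈ with P? u | trans (sym (lookup∘tabulate (does ∘ P?) u)) ([]=⇒lookup u∈)
  ... | yes p | _ = p

module _ {n : ℕ} {R : Fin n → Fin n → Set} (R? : ∀ u v → Dec (R u v)) where

  matrix : Adjacency n
  matrix = tabulate λ u → subset (R? u)

  matrix⁺ : ∀ {u v} → R u v → Joins matrix u v
  matrix⁺ {u} {v} r = subst (v ∈_) (sym (lookup∘tabulate _ u)) (∈subset⁺ (R? u) r)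

  matrix⁻ : ∀ {u v} → Joins matrix u v → R u v
  matrix⁻ {u} {v} j = ∈subset⁻ (R? u) (subst (v ∈_) (lookup∘tabulate _ u) j)

module _ {n : ℕ} {E : Fin n → Fin n → Set} {v p : Fin n}
         (out : ∀ w → E v w → w ≡ p) (into : ∀ w → E w v → w ≡ p) where

  predecessor : ∀ a xs {z} → Linked E (a ∷ xs ++ z ∷ []) → ∃[ w ] w ∈ₗ a ∷ xs × E w z
  predecessor a []       (e ∷ _) = a , here refl , e
  predecessor a (x ∷ xs) (_ ∷ l) =
    let (w , w∈ , e) = predecessor x xs l in w , there w∈ , e

  -- A cycle enters and leaves a vertex by different neighbours.
  leaf∉inside : ∀ {a z} xs → a ≢ z ⊎ 2 ≤ length xs → Unique (a ∷ xs) → z ∉ₗ xs →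
    Linked E (a ∷ xs ++ z ∷ []) → v ∉ₗ xs
  leaf∉inside (x ∷ []) (inj₁ a≢z) _ _ (e ∷ f ∷ _) (here refl) =
    a≢z (trans (into _ e) (sym (out _ f)))
  leaf∉inside (x ∷ []) (inj₂ (s≤s ())) _ _ _ _
  leaf∉inside (x ∷ y ∷ _) _ ((_ ∷ a≢y ∷ _) ∷ _) _ (e ∷ f ∷ _) (here refl) =
    a≢y (trans (into _ e) (sym (out _ f)))
  -- One step on, the preceding vertex `x` is itself inside and so differs from `z`. The length
  -- alternative serves the first call, where `a` and `z` are the same vertex of the cycle.
  leaf∉inside (x ∷ xs) _ (_ ∷ uniq) z∉ (_ ∷ l) (there v∈) =
    leaf∉inside xs (inj₁ λ x≡z → z∉ (here (sym x≡z))) uniq (z∉ ∘ there) l v∈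

  leaf∉cycle : ∀ {u vs} → IsCycle E u vs → v ∉ₗ u ∷ vs
  -- The leaf is the start of the cycle. Its neighbours there are `a` and the last vertex `w`, which
  -- lies in `b ∷ vs` and so differs from `a`.
  leaf∉cycle {vs = a ∷ b ∷ vs} (_ , _ ∷ (a∉ ∷ _) , e ∷ _ ∷ l) (here refl) =
    let (w , w∈ , f) = predecessor b vs l
    in All.lookup a∉ w∈ (trans (out a e) (sym (into w f)))
  leaf∉cycle {vs = vs} (2≤ , uniq@(u∉ ∷ _) , l) (there v∈) =
    leaf∉inside vs (inj₂ 2≤) uniq (λ u∈ → All.lookup u∉ u∈ refl) l v∈
  leaf∉cycle {vs = []} (() , _) _
  leaf∉cycle {vs = _ ∷ []} (s≤s () , _) _

module _ {n c : ℕ} (G : Graph n) (χ : Colouring n c) (root : Fin n) where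

  reached : List (Fin n × Fin n) → List (Fin n)
  reached es = root ∷ map proj₁ es

  tint : Fin n × Fin n → Fin c
  tint (v , p) = colour χ v p

  tints : List (Fin n × Fin n) → List (Fin c)
  tints = map tint

  -- The edges (child , parent) of a rainbow tree, the most recent leaf first.
  data Growth : List (Fin n × Fin n) → Set where
    seed : Growth []
    leaf : ∀ {v p es} → v ∉ₗ reached es → p ∈ₗ reached es → Adj G v p →
      colour χ v p ∉ₗ tints es → Growth es → Growth ((v , p) ∷ es)

  -- Indexed by its colours, which are pairwise distinct; the intermediate vertices are forgotten,
  -- as routes are compared by colour alone.
  data Route : Fin n → List (Fin c) → Set where
    arrived : Route root []
    step    : ∀ {u v t ts} → Adj G u v → colour χ u v ≡ t → t ∉ₗ ts → Route v ts →
      Route u (t ∷ ts)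

  open DecMembership (_≟_ {n}) using () renaming (_∈?_ to _∈ᵥ?_)
  open DecMembership (≡-dec (_≟_ {n}) (_≟_ {n})) using () renaming (_∈?_ to _∈ₑ?_)

  Link : List (Fin n × Fin n) → Fin n → Fin n → Set
  Link es u v = (u , v) ∈ₗ es ⊎ (v , u) ∈ₗ es

  link? : ∀ es u v → Dec (Link es u v)
  link? es u v = ((u , v) ∈ₑ? es) ⊎-dec ((v , u) ∈ₑ? es)

  child-reached : ∀ {es u v} → (u , v) ∈ₗ es → u ∈ₗ reached es
  child-reached e = there (∈-map⁺ proj₁ e)

  parent-reached : ∀ {es u v} → Growth es → (u , v) ∈ₗ es → v ∈ₗ reached es
  parent-reached (leaf _ p∈ _ _ _) (here refl) with p∈
  ... | here eq = here eq
  ... | there q = there (there q)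
  parent-reached (leaf _ _ _ _ g) (there e) with parent-reached g e
  ... | here eq = here eq
  ... | there q = there (there q)

  link-reached : ∀ {es u v} → Growth es → Link es u v → u ∈ₗ reached es
  link-reached g (inj₁ e) = child-reached e
  link-reached g (inj₂ e) = parent-reached g e

  link-adjacent : ∀ {es u v} → Growth es → Link es u v → Adj G u v
  link-adjacent (leaf _ _ a _ _) (inj₁ (here refl)) = a
  link-adjacent (leaf _ _ a _ _) (inj₂ (here refl)) = Graph.symmetric G _ _ a
  link-adjacent (leaf _ _ _ _ g) (inj₁ (there e)) = link-adjacent g (inj₁ e)
  link-adjacent (leaf _ _ _ _ g) (inj₂ (there e)) = link-adjacent g (inj₂ e)

  -- `v` is new, so it is neither end of an older edge, and it differs from `p`, which was reached
  -- before.
  leaf-link : ∀ {es v p w} → Growth ((v , p) ∷ es) → Link ((v , p) ∷ es) v w → w ≡ p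
  leaf-link _ (inj₁ (here refl)) = refl
  leaf-link (leaf v∉ _ _ _ _) (inj₁ (there e)) = contradiction (child-reached e) v∉
  leaf-link (leaf v∉ p∈ _ _ _) (inj₂ (here refl)) = contradiction p∈ v∉
  leaf-link (leaf v∉ _ _ _ g) (inj₂ (there e)) = contradiction (parent-reached g e) v∉

  prune : ∀ {es v p xs} → v ∉ₗ xs → Linked (Link ((v , p) ∷ es)) xs → Linked (Link es) xs
  prune v∉ [] = []
  prune v∉ [-] = [-]
  prune v∉ (inj₁ (here refl) ∷ l) = contradiction (here refl) v∉
  prune v∉ (inj₂ (here refl) ∷ l) = contradiction (there (here refl)) v∉
  prune v∉ (inj₁ (there e) ∷ l) = inj₁ e ∷ prune (v∉ ∘ there) l
  prune v∉ (inj₂ (there e) ∷ l) = inj₂ e ∷ prune (v∉ ∘ there) l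

  -- The newest vertex has a single neighbour and so lies on no cycle. A cycle would therefore use
  -- older edges only.
  growth-acyclic : ∀ {es} → Growth es → ∀ u vs → ¬ IsCycle (Link es) u vs
  growth-acyclic seed u [] (() , _)
  growth-acyclic seed u (_ ∷ _) (_ , _ , inj₁ () ∷ _)
  growth-acyclic seed u (_ ∷ _) (_ , _ , inj₂ () ∷ _)
  growth-acyclic g@(leaf {v} _ _ _ _ g′) u vs cycle@(2≤ , uniq , l) =
    growth-acyclic g′ u vs (2≤ , uniq , prune v∉walk l)
    where
    v∉ : v ∉ₗ u ∷ vs
    v∉ = leaf∉cycle (λ _ → leaf-link g) (λ _ → leaf-link g ∘ swap) cycle
    v∉walk : v ∉ₗ u ∷ vs ++ u ∷ []
    v∉walk v∈ with ∈-++⁻ (u ∷ vs) v∈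
    ... | inj₁ v∈′ = v∉ v∈′
    ... | inj₂ (here refl) = v∉ (here refl)

  to-root : ∀ {es} → Growth es → ∀ {u} → u ∈ₗ reached es → Star (Link es) u root
  to-root g (here refl) = ε
  to-root (leaf _ p∈ _ _ g) (there (here refl)) =
    inj₁ (here refl) ◅ Star.map (Sum.map there there) (to-root g p∈)
  to-root (leaf _ _ _ _ g) (there (there u∈)) =
    Star.map (Sum.map there there) (to-root g (there u∈))

  tint-injective : ∀ {es} → Growth es → ∀ {u v x y} → (u , v) ∈ₗ es → (x , y) ∈ₗ es →
    colour χ u v ≡ colour χ x y → u ≡ x × v ≡ y
  tint-injective _ (here refl) (here refl) _ = refl , refl
  tint-injective (leaf {es = es} _ _ _ t∉ _) (here refl) (there f) eq =
    contradiction (subst (_∈ₗ tints es) (sym eq) (∈-map⁺ tint f)) t∉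
  tint-injective (leaf {es = es} _ _ _ t∉ _) (there e) (here refl) eq =
    contradiction (subst (_∈ₗ tints es) eq (∈-map⁺ tint e)) t∉
  tint-injective (leaf _ _ _ _ g) (there e) (there f) eq = tint-injective g e f eq

  link-rainbow : ∀ {es} → Growth es → ∀ {u v x y} → Link es u v → Link es x y →
    colour χ u v ≡ colour χ x y → (u ≡ x × v ≡ y) ⊎ (u ≡ y × v ≡ x)
  link-rainbow g (inj₁ e) (inj₁ f) eq = inj₁ (tint-injective g e f eq)
  link-rainbow g (inj₁ e) (inj₂ f) eq =
    inj₂ (tint-injective g e f (trans eq (Colouring.symmetric χ _ _)))
  link-rainbow g (inj₂ e) (inj₁ f) eq =
    let (v≡x , u≡y) = tint-injective g e f (trans (Colouring.symmetric χ _ _) eq)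
    in inj₂ (u≡y , v≡x)
  link-rainbow g (inj₂ e) (inj₂ f) eq =
    let (v≡y , u≡x) = tint-injective g e f
                        (trans (Colouring.symmetric χ _ _) (trans eq (Colouring.symmetric χ _ _)))
    in inj₁ (u≡x , v≡y)

  grown : ∀ {es} → Growth es → Subgraph G
  grown {es} g = record
    { vertices  = subset (_∈ᵥ? reached es)
    ; adjacency = matrix (link? es)
    ; symmetric = λ u v → matrix⁺ (link? es) ∘ swap ∘ matrix⁻ (link? es)
    ; edges⊆    = λ u v → link-adjacent g ∘ matrix⁻ (link? es)
    ; endpoint  = λ u v → ∈subset⁺ (_∈ᵥ? reached es) ∘ link-reached g ∘ matrix⁻ (link? es)
    }

  grown-rainbow : ∀ {es} (g : Growth es) {S} → (∀ {u} → u ∈ S → u ∈ₗ reached es) →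
    IsRainbowSTree χ S (grown g)
  grown-rainbow {es} g S⊆ =
    record
      { nonempty  = root , ∈subset⁺ (_∈ᵥ? reached es) (here refl)
      ; connected = λ u v u∈ v∈ →
          Star.map (matrix⁺ (link? es))
            (to-root g (∈subset⁻ (_∈ᵥ? reached es) u∈)
              ◅◅ reverse swap (to-root g (∈subset⁻ (_∈ᵥ? reached es) v∈)))
      ; acyclic   = λ u vs (2≤ , uniq , l) →
          growth-acyclic g u vs (2≤ , uniq , Linked.map (matrix⁻ (link? es)) l)
      } ,
    (λ u v x y e f → link-rainbow g (matrix⁻ (link? es) e) (matrix⁻ (link? es) f)) ,
    ∈subset⁺ (_∈ᵥ? reached es) ∘ S⊆

  -- The route is added from its root end outwards, each edge as a new leaf unless its outer end is
  -- already reached; skipping such edges keeps a tree where routes share vertices. The bound on the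
  -- tints makes the next colour fresh, both here and for the next route.
  attach : ∀ {es u ts} → Growth es → Route u ts →
    u ∈ₗ reached es ⊎ (∀ {t} → t ∈ₗ ts → t ∉ₗ tints es) →
    ∃[ fs ] Growth fs × u ∈ₗ reached fs × (∀ {v} → v ∈ₗ reached es → v ∈ₗ reached fs) ×
            (∀ {t} → t ∈ₗ tints fs → t ∈ₗ ts ⊎ t ∈ₗ tints es)
  attach {es} g r (inj₁ u∈) = es , g , u∈ , id , inj₂
  attach {es} g arrived (inj₂ _) = es , g , here refl , id , inj₂
  attach {es} {u} {ts} g (step {v = p} adj refl t∉ r) (inj₂ fresh)
    with attach g r (inj₂ (fresh ∘ there))
  ... | (fs , g′ , p∈ , es⊆fs , tints⊆) with u ∈ᵥ? reached fs
  ...   | yes u∈ = fs , g′ , u∈ , es⊆fs , Sum.map₁ there ∘ tints⊆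
  ...   | no u∉ = _ , leaf u∉ p∈ adj t∉′ g′ , there (here refl) , grow ∘ es⊆fs , tints⊆′
    where
    t∉′ : _ ∉ₗ tints fs
    t∉′ t∈ = [ t∉ , fresh (here refl) ]′ (tints⊆ t∈)
    grow : ∀ {v} → v ∈ₗ reached fs → v ∈ₗ reached ((u , p) ∷ fs)
    grow (here eq) = here eq
    grow (there v∈) = there (there v∈)
    tints⊆′ : ∀ {t} → t ∈ₗ tints ((u , p) ∷ fs) → t ∈ₗ ts ⊎ t ∈ₗ tints es
    tints⊆′ (here eq) = inj₁ (here eq)
    tints⊆′ (there t∈) = Sum.map₁ there (tints⊆ t∈)

  -- Equal vertices count as apart because the second one is already in the tree when its turn
  -- comes.
  Apart : Fin n → List (Fin c) → Fin n → List (Fin c) → Set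
  Apart u ts v ss = u ≡ v ⊎ All (_∉ₗ ss) ts

  tree-of-routes : ∀ {x y z rs ss ts S} → Route x rs → Route y ss → Route z ts →
    Apart y ss x rs → Apart z ts x rs → Apart z ts y ss →
    (∀ {u} → u ∈ S → u ∈ₗ x ∷ y ∷ z ∷ []) → ∃[ T ] IsRainbowSTree {G = G} χ S T
  tree-of-routes {x} {y} {z} {rs} {ss} {ts} {S} rx ry rz yx zx zy S⊆ =
    let (es , g , x∈ , _ , tints₁) = attach seed rx (inj₂ λ _ ())
        (fs , h , y∈ , es⊆fs , tints₂) =
          attach g ry (Sum.map (λ { refl → x∈ }) (λ a t∈ → All.lookup a t∈ ∘ from-first tints₁) yx)
        (hs , k , z∈ , fs⊆hs , _) =
          attach h rz (third (es⊆fs x∈) y∈ (Sum.map₂ (from-first tints₁) ∘ tints₂) zx zy)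
    in grown k , grown-rainbow k (covered (fs⊆hs (es⊆fs x∈)) (fs⊆hs y∈) z∈ ∘ S⊆)
    where
    from-first : ∀ {es} → (∀ {t} → t ∈ₗ tints es → t ∈ₗ rs ⊎ t ∈ₗ []) →
      ∀ {t} → t ∈ₗ tints es → t ∈ₗ rs
    from-first tints⊆ t∈ with tints⊆ t∈
    ... | inj₁ t∈rs = t∈rs
    third : ∀ {fs} → x ∈ₗ reached fs → y ∈ₗ reached fs →
      (∀ {t} → t ∈ₗ tints fs → t ∈ₗ ss ⊎ t ∈ₗ rs) → Apart z ts x rs → Apart z ts y ss →
      z ∈ₗ reached fs ⊎ (∀ {t} → t ∈ₗ ts → t ∉ₗ tints fs)
    third x∈ y∈ tints⊆ (inj₁ refl) _ = inj₁ x∈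
    third x∈ y∈ tints⊆ (inj₂ _) (inj₁ refl) = inj₁ y∈
    third x∈ y∈ tints⊆ (inj₂ zx) (inj₂ zy) = inj₂ λ t∈ t∈fs →
      [ All.lookup zy t∈ , All.lookup zx t∈ ]′ (tints⊆ t∈fs)
    covered : ∀ {es} → x ∈ₗ reached es → y ∈ₗ reached es → z ∈ₗ reached es →
      ∀ {u} → u ∈ₗ x ∷ y ∷ z ∷ [] → u ∈ₗ reached es
    covered x∈ y∈ z∈ (here refl) = x∈
    covered x∈ y∈ z∈ (there (here refl)) = y∈
    covered x∈ y∈ z∈ (there (there (here refl))) = z∈

-- Graphs with a hub

-- Pigeonhole: distinct entries of `xs` occupy distinct positions in `ys`.
Unique-⊆⇒length≤ : ∀ {A : Set} {xs ys : List A} → Unique xs →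
  (∀ {x} → x ∈ₗ xs → x ∈ₗ ys) → length xs ≤ length ys
Unique-⊆⇒length≤ {xs = xs} {ys} uniq xs⊆ys = injective⇒≤ {f = place} injective
  where
  place : Fin (length xs) → Fin (length ys)
  place i = index (xs⊆ys (∈-lookup i))
  found : ∀ i → List.lookup xs i ≡ List.lookup ys (place i)
  found i = lookup-index (xs⊆ys (∈-lookup i))
  injective : ∀ {i j} → place i ≡ place j → i ≡ j
  injective {i} {j} eq = Unique-lookup-injective uniq
    (trans (found i) (trans (cong (List.lookup ys) eq) (sym (found j))))

elements : ∀ {n} (S : Subset n) →
  ∃[ xs ] length xs ≡ ∣ S ∣ × (∀ {u} → u ∈ S → u ∈ₗ xs)
elements [] = [] , refl , λ ()
elements (outside ∷ S) =
  let (xs , eq , S⊆xs) = elements S in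
  map suc xs , trans (length-map suc xs) eq , λ { (there u∈) → ∈-map⁺ suc (S⊆xs u∈) }
elements (inside ∷ S) =
  let (xs , eq , S⊆xs) = elements S in
  zero ∷ map suc xs , cong suc (trans (length-map suc xs) eq) ,
  λ { here → here refl ; (there u∈) → there (∈-map⁺ suc (S⊆xs u∈)) }

module _ {m : ℕ} (next : Fin m → Fin m) where

  -- `next` may have fixed points; the condition `u ≢ v` keeps them from becoming loops.
  Spoked : Fin (suc m) → Fin (suc m) → Set
  Spoked zero    zero    = ⊥
  Spoked zero    (suc v) = ⊤
  Spoked (suc u) zero    = ⊤
  Spoked (suc u) (suc v) = u ≢ v × (next u ≡ v ⊎ next v ≡ u)

  spoked? : ∀ u v → Dec (Spoked u v)
  spoked? zero    zero    = no λ ()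
  spoked? zero    (suc v) = yes tt
  spoked? (suc u) zero    = yes tt
  spoked? (suc u) (suc v) = ¬? (u ≟ v) ×-dec ((next u ≟ v) ⊎-dec (next v ≟ u))

  spoked-sym : ∀ u v → Spoked u v → Spoked v u
  spoked-sym zero    (suc v) _ = tt
  spoked-sym (suc u) zero    _ = tt
  spoked-sym (suc u) (suc v) (u≢v , e) = u≢v ∘ sym , swap e

  spoked-irrefl : ∀ u → ¬ Spoked u u
  spoked-irrefl (suc u) (u≢u , _) = u≢u refl

  spokedGraph : Graph (suc m)
  spokedGraph = record
    { adjacency   = matrix spoked?
    ; symmetric   = λ u v → matrix⁺ spoked? ∘ spoked-sym u v ∘ matrix⁻ spoked?
    ; irreflexive = λ u → spoked-irrefl u ∘ matrix⁻ spoked?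
    }

  spoked-connected : Connected spokedGraph
  spoked-connected zero    zero    = ε
  spoked-connected zero    (suc v) = matrix⁺ spoked? {zero} {suc v} tt ◅ ε
  spoked-connected (suc u) zero    = matrix⁺ spoked? {suc u} {zero} tt ◅ ε
  spoked-connected (suc u) (suc v) =
    matrix⁺ spoked? {suc u} {zero} tt ◅ matrix⁺ spoked? {zero} {suc v} tt ◅ ε

  -- Oriented upwards, as `size` counts edges. At a fixed point of `next` the pair is a loop, which
  -- merely pads the list.
  outgoing : Fin m → Fin (suc m) × Fin (suc m)
  outgoing v with v <? next v
  ... | yes _ = suc v , suc (next v)
  ... | no _  = suc (next v) , suc v

  outgoing-up : ∀ {u v} → u Fin.< v → next u ≡ v → outgoing u ≡ (suc u , suc v)
  outgoing-up {u} u<v refl with u <? next u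
  ... | yes _  = refl
  ... | no u≮v = contradiction u<v u≮v

  outgoing-down : ∀ {u v} → u Fin.< v → next v ≡ u → outgoing v ≡ (suc u , suc v)
  outgoing-down {v = v} u<v refl with v <? next v
  ... | yes v<u = contradiction v<u (<-asym u<v)
  ... | no _    = refl

  spokes+outgoing : List (Fin (suc m) × Fin (suc m))
  spokes+outgoing = map (λ v → zero , suc v) (allFin m) ++ map outgoing (allFin m)

  listed : ∀ u v → u Fin.< v → Spoked u v → (u , v) ∈ₗ spokes+outgoing
  listed zero (suc v) _ _ = ∈-++⁺ˡ (∈-map⁺ (λ w → zero , suc w) (∈-allFin v))
  listed (suc u) (suc v) (s≤s u<v) (_ , inj₁ eq) =
    ∈-++⁺ʳ _ (subst (_∈ₗ map outgoing (allFin m)) (outgoing-up u<v eq)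
               (∈-map⁺ outgoing (∈-allFin u)))
  listed (suc u) (suc v) (s≤s u<v) (_ , inj₂ eq) =
    ∈-++⁺ʳ _ (subst (_∈ₗ map outgoing (allFin m)) (outgoing-down u<v eq)
               (∈-map⁺ outgoing (∈-allFin v)))

  length-spokes+outgoing : length spokes+outgoing ≡ m + m
  length-spokes+outgoing =
    trans (length-++ (map (λ v → zero , suc v) (allFin m)))
          (cong₂ _+_ (length-map-allFin λ v → zero , suc v) (length-map-allFin outgoing))
    where
    length-map-allFin : ∀ (f : Fin m → Fin (suc m) × Fin (suc m)) → length (map f (allFin m)) ≡ m
    length-map-allFin f = trans (length-map f (allFin m)) (length-tabulate {n = m} id)

  -- The counted edges are distinct and all occur in `spokes+outgoing`; repetitions in that list
  -- only weaken the bound.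
  spoked-size : size spokedGraph ≤ m + m
  spoked-size =
    ≤-trans
      (Unique-⊆⇒length≤
        (filter⁺ edge? (cartesianProduct⁺ (allFin⁺ (suc m)) (allFin⁺ (suc m))))
        (λ {(u , v)} e →
          let (_ , u<v , j) =
                ∈-filter⁻ edge? {xs = cartesianProduct (allFin (suc m)) (allFin (suc m))} e
          in listed u v u<v (matrix⁻ spoked? j)))
      (≤-reflexive length-spokes+outgoing)
    where
    edge? : (e : Fin (suc m) × Fin (suc m)) →
      Dec (proj₁ e Fin.< proj₂ e × Joins (matrix spoked?) (proj₁ e) (proj₂ e))
    edge? (u , v) = (u <? v) ×-dec joins? (matrix spoked?) u v

-- Hexagons and extra vertices

turn back : Fin 6 → Fin 6
turn 0F = 1F
turn 1F = 2F
turn 2F = 3F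
turn 3F = 4F
turn 4F = 5F
turn 5F = 0F

back 0F = 5F
back 1F = 0F
back 2F = 1F
back 3F = 2F
back 4F = 3F
back 5F = 4F

-- A rim kind forgets which hexagon the vertex is on, so that one finite check serves any number of
-- hexagons.
data Kind : Set where
  hub   : Kind
  rim   : Fin 6 → Kind
  extra : Fin 5 → Kind

all-kinds? : {P : Kind → Set} → (∀ k → Dec (P k)) → Dec (∀ k → P k)
all-kinds? P? =
  map′ (λ { (h , r , e) hub → h ; (h , r , e) (rim i) → r i ; (h , r , e) (extra k) → e k })
       (λ p → p hub , p ∘ rim , p ∘ extra)
       (P? hub ×-dec all? (P? ∘ rim) ×-dec all? (P? ∘ extra))

Colour : Set
Colour = Fin 5

-- The spoke of the hub itself is a junk value.
spoke : Kind → Colour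
spoke hub        = 0F
spoke (rim 0F)   = 0F
spoke (rim 1F)   = 1F
spoke (rim 2F)   = 2F
spoke (rim 3F)   = 0F
spoke (rim 4F)   = 1F
spoke (rim 5F)   = 2F
spoke (extra 0F) = 3F
spoke (extra 1F) = 4F
spoke (extra 2F) = 0F
spoke (extra 3F) = 1F
spoke (extra 4F) = 2F

-- Entry `i` colours the edge from `i` to `turn i`. By the alternation every rim vertex meets both
-- `3F` and `4F`.
seam : Fin 6 → Colour
seam 0F = 3F
seam 1F = 4F
seam 2F = 3F
seam 3F = 4F
seam 4F = 3F
seam 5F = 4F

-- Entry `e` belongs to the extra vertex `suc e`. It avoids that vertex's own spoke colour and `3F`,
-- the spoke colour of the first extra vertex.
tie : Fin 4 → Colour
tie 0F = 0F
tie 1F = 2F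
tie 2F = 0F
tie 3F = 1F

-- Pairs of kinds that never span an edge get the junk value 0F.
tone : Kind → Kind → Colour
tone hub             l               = spoke l
tone k               hub             = spoke k
tone (rim i)         (rim j)         =
  if does (turn i ≟ j) then seam i else if does (turn j ≟ i) then seam j else 0F
tone (extra 0F)      (extra (suc f)) = tie f
tone (extra (suc e)) (extra 0F)      = tie e
tone _               _               = 0F

tone-sym : ∀ k l → tone k l ≡ tone l k
tone-sym = toWitness {a? = all-kinds? λ k → all-kinds? λ l → tone k l ≟ tone l k} tt

-- Routes by kind and the finite check

detour : Kind → Kind → List Colour
detour k l = tone k l ∷ spoke l ∷ []

options : Kind → List (List Colour)
options hub             = [] ∷ []
options (rim i)         =
  [ spoke (rim i) ] ∷ detour (rim i) (rim (turn i)) ∷ detour (rim i) (rim (back i)) ∷ []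
options (extra 0F)      = [ spoke (extra 0F) ] ∷ []
options (extra (suc e)) = [ spoke (extra (suc e)) ] ∷ detour (extra (suc e)) (extra 0F) ∷ []

-- Kinds that force equal vertices. The check needs this for a repeated extra vertex, as `extra 0F`
-- has a single option. Rim kinds recur in every hexagon, and the empty route of the hub is disjoint
-- from all others.
Sole : Kind → Kind → Set
Sole (extra e) (extra f) = e ≡ f
Sole _         _         = ⊥

sole? : ∀ k l → Dec (Sole k l)
sole? hub       _         = no λ ()
sole? (rim _)   _         = no λ ()
sole? (extra _) hub       = no λ ()
sole? (extra _) (rim _)   = no λ ()
sole? (extra e) (extra f) = e ≟ f

Clear : Kind → List Colour → Kind → List Colour → Set
Clear k ts l ss = Sole k l ⊎ All (_∉ₗ ss) ts

open DecMembership (_≟_ {5}) using () renaming (_∈?_ to _∈ₜ?_)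

clear? : ∀ k ts l ss → Dec (Clear k ts l ss)
clear? k ts l ss = sole? k l ⊎-dec All.all? (λ t → ¬? (t ∈ₜ? ss)) ts

Compatible : Kind → Kind → Kind → Set
Compatible a b c =
  Any (λ rs → Any (λ ss → Any (λ ts → Clear b ss a rs × Clear c ts a rs × Clear c ts b ss)
    (options c)) (options b)) (options a)

compatible? : ∀ a b c → Dec (Compatible a b c)
compatible? a b c =
  Any.any? (λ rs → Any.any? (λ ss → Any.any? (λ ts →
    clear? b ss a rs ×-dec clear? c ts a rs ×-dec clear? c ts b ss)
    (options c)) (options b)) (options a)

-- Evaluation over all triples of the 12 kinds. Three vertices of one rim kind, for instance, take
-- the spoke and the two detours, which use each of the five colours once.
compatible : ∀ a b c → Compatible a b c
compatible =
  toWitness {a? = all-kinds? λ a → all-kinds? λ b → all-kinds? λ c → compatible? a b c} tt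

turn-back : ∀ i → turn (back i) ≡ i
turn-back = toWitness {a? = all? λ i → turn (back i) ≟ i} tt

turn≢ : ∀ i → i ≢ turn i
turn≢ = toWitness {a? = all? λ i → ¬? (i ≟ turn i)} tt

turn-detour : ∀ i → tone (rim i) (rim (turn i)) ≢ spoke (rim (turn i))
turn-detour = toWitness {a? = all? λ i → ¬? (tone (rim i) (rim (turn i)) ≟ spoke (rim (turn i)))} tt

back-detour : ∀ i → tone (rim i) (rim (back i)) ≢ spoke (rim (back i))
back-detour = toWitness {a? = all? λ i → ¬? (tone (rim i) (rim (back i)) ≟ spoke (rim (back i)))} tt

tie-detour : ∀ e → tie e ≢ 3F
tie-detour = toWitness {a? = all? λ e → ¬? (tie e ≟ 3F)} tt

-- The coloured graph with `q` hexagons and `r` extra vertices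

module _ (q r : ℕ) (r≤5 : r ≤ 5) where

  -- Extra vertices come first so that their number `r + q * 6` has the shape of division with
  -- remainder.
  Place : Set
  Place = Fin r ⊎ (Fin q × Fin 6)

  places : Fin (r + q * 6) ↔ Place
  places = ↔-trans +↔⊎ (↔-refl ⊎-↔ *↔×)

  open Inverse places using () renaming
    ( to to decode; from to encode
    ; strictlyInverseˡ to decode∘encode; strictlyInverseʳ to encode∘decode)

  decode-injective : ∀ {u v} → decode u ≡ decode v → u ≡ v
  decode-injective {u} {v} eq =
    trans (sym (encode∘decode u)) (trans (cong encode eq) (encode∘decode v))

  first : ∀ {k} → Fin k → Fin k
  first {suc _} _ = zero

  -- The first extra vertex is a fixed point, so the extra vertices span a star around it.
  nextPlace : Place → Place
  nextPlace (inj₁ e)       = inj₁ (first e)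
  nextPlace (inj₂ (b , i)) = inj₂ (b , turn i)

  kindOf : Place → Kind
  kindOf (inj₁ e)       = extra (inject≤ e r≤5)
  kindOf (inj₂ (_ , i)) = rim i

  next : Fin (r + q * 6) → Fin (r + q * 6)
  next = encode ∘ nextPlace ∘ decode

  G : Graph (suc (r + q * 6))
  G = spokedGraph next

  kind : Fin (suc (r + q * 6)) → Kind
  kind zero    = hub
  kind (suc v) = kindOf (decode v)

  χ : Colouring (suc (r + q * 6)) 5
  χ = record
    { colour    = λ u v → tone (kind u) (kind v)
    ; symmetric = λ u v → tone-sym (kind u) (kind v)
    }

  next-from : ∀ {u v p} → decode u ≡ p → decode v ≡ nextPlace p → next u ≡ v
  next-from {v = v} du dv =
    trans (cong (encode ∘ nextPlace) du) (trans (cong encode (sym dv)) (encode∘decode v))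

  adjacent : ∀ {u v p p′} → decode u ≡ p → decode v ≡ p′ → p ≢ p′ →
    nextPlace p ≡ p′ ⊎ nextPlace p′ ≡ p → Adj G (suc u) (suc v)
  adjacent {u} {v} du dv p≢p′ e = matrix⁺ (spoked? next) (u≢v , link e)
    where
    u≢v : u ≢ v
    u≢v refl = p≢p′ (trans (sym du) dv)
    link : nextPlace _ ≡ _ ⊎ nextPlace _ ≡ _ → next u ≡ v ⊎ next v ≡ u
    link (inj₁ eq) = inj₁ (next-from du (trans dv (sym eq)))
    link (inj₂ eq) = inj₂ (next-from dv (trans du (sym eq)))

  spoke-tone : ∀ p → tone (kindOf p) hub ≡ spoke (kindOf p)
  spoke-tone (inj₁ zero)    = refl
  spoke-tone (inj₁ (suc e)) = refl
  spoke-tone (inj₂ _) = refl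

  direct : ∀ {u p} → decode u ≡ p → Route G χ zero (suc u) (spoke (kindOf p) ∷ [])
  direct {u} {p} refl =
    step (matrix⁺ (spoked? next) {suc u} {zero} tt) (spoke-tone p) (λ ()) arrived

  via : ∀ {u p} p′ → decode u ≡ p → p ≢ p′ → nextPlace p ≡ p′ ⊎ nextPlace p′ ≡ p →
    tone (kindOf p) (kindOf p′) ≢ spoke (kindOf p′) →
    Route G χ zero (suc u) (detour (kindOf p) (kindOf p′))
  via {u} {p} p′ refl p≢p′ e t≢ =
    step (adjacent {u} {encode p′} refl (decode∘encode p′) p≢p′ e)
         (cong (tone (kindOf p) ∘ kindOf) (decode∘encode p′))
         (λ { (here eq) → t≢ eq })
         (direct (decode∘encode p′))

  -- `options` only lists colours; here each list is backed by edges of `G`: the vertex's own spoke,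
  -- or an edge to a neighbour followed by the neighbour's spoke.
  realize-at : ∀ u p → decode u ≡ p → ∀ {ts} → ts ∈ₗ options (kindOf p) → Route G χ zero (suc u) ts
  realize-at u (inj₂ (b , i)) du (here refl) = direct du
  realize-at u (inj₂ (b , i)) du (there (here refl)) =
    via (inj₂ (b , turn i)) du (turn≢ i ∘ ,-injectiveʳ ∘ inj₂-injective) (inj₁ refl) (turn-detour i)
  realize-at u (inj₂ (b , i)) du (there (there (here refl))) =
    via (inj₂ (b , back i)) du
      (λ eq → turn≢ (back i) (trans (sym (,-injectiveʳ (inj₂-injective eq))) (sym (turn-back i))))
      (inj₂ (cong (λ j → inj₂ (b , j)) (turn-back i))) (back-detour i)
  realize-at u (inj₁ zero) du (here refl) = direct du
  realize-at u (inj₁ (suc e)) du (here refl) = direct du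
  realize-at u (inj₁ (suc e)) du (there (here refl)) =
    via (inj₁ zero) du (λ ()) (inj₁ refl) (tie-detour _)

  realize : ∀ u {ts} → ts ∈ₗ options (kind u) → Route G χ zero u ts
  realize zero (here refl) = arrived
  realize (suc u) ts∈ = realize-at u (decode u) refl ts∈

  sole-place : ∀ p p′ → Sole (kindOf p) (kindOf p′) → p ≡ p′
  sole-place (inj₁ e) (inj₁ f) eq = cong inj₁ (inject≤-injective r≤5 r≤5 e f eq)

  sole-vertex : ∀ u v → Sole (kind u) (kind v) → u ≡ v
  sole-vertex (suc u) (suc v) s = cong suc (decode-injective (sole-place (decode u) (decode v) s))
  sole-vertex (suc u) zero s with decode u
  sole-vertex (suc u) zero () | inj₁ _
  sole-vertex (suc u) zero () | inj₂ _

  apart : ∀ u v {ts ss} → Clear (kind u) ts (kind v) ss → Apart G χ zero u ts v ss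
  apart u v (inj₁ s) = inj₁ (sole-vertex u v s)
  apart u v (inj₂ d) = inj₂ d

  χ-rainbow : IsRainbowColouring 3 G χ
  χ-rainbow S ∣S∣≡3 with elements S
  ... | [] , eq , _ = contradiction (trans eq ∣S∣≡3) λ ()
  ... | _ ∷ [] , eq , _ = contradiction (trans eq ∣S∣≡3) λ ()
  ... | _ ∷ _ ∷ [] , eq , _ = contradiction (trans eq ∣S∣≡3) λ ()
  ... | _ ∷ _ ∷ _ ∷ _ ∷ _ , eq , _ = contradiction (trans eq ∣S∣≡3) λ ()
  ... | x ∷ y ∷ z ∷ [] , _ , S⊆ =
    let (rs , rs∈ , p) = find (compatible (kind x) (kind y) (kind z))
        (ss , ss∈ , p′) = find p
        (ts , ts∈ , yx , zx , zy) = find p′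
    in tree-of-routes G χ zero (realize x rs∈) (realize y ss∈) (realize z ts∈)
         (apart y x yx) (apart z x zx) (apart z y zy) S⊆

  minSize-bound : ∃[ m ] MinSize (suc (r + q * 6)) 3 5 m × m ≤ (r + q * 6) + (r + q * 6)
  minSize-bound =
    let (m , min , m≤) = MinSize-≤ G (spoked-connected next)
                           (RainbowIndex≤-intro 3 G (χ , χ-rainbow) ≤-refl)
    in m , min , ≤-trans m≤ (spoked-size next)

proposition2p9 : ∀ (n : ℕ) → 3 ≤ n → ∃[ m ] (MinSize n 3 5 m × m ≤ 2 * n ∸ 2)
proposition2p9 (suc k) _ =
  -- `k` is `n − 1`, the number of vertices besides the hub: `k / 6` hexagons and `k % 6` extra
  -- vertices.
  let (m , min , m≤) = subst (λ k → ∃[ m ] MinSize (suc k) 3 5 m × m ≤ k + k)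
                         (sym (m≡m%n+[m/n]*n k 6))
                         (minSize-bound (k / 6) (k % 6) (s≤s⁻¹ (m%n<n k 6)))
  in m , min , ≤-trans m≤ (≤-reflexive (sym (twice k)))
  where
  twice : ∀ k → 2 * suc k ∸ 2 ≡ k + k
  twice k rewrite +-suc k (k + 0) | +-identityʳ k = refl
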